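{- For all integers $3 \le t \le k$ there exists $c=c(k)$ such that for all integers $n>k+1$, $r_k(k+1, t; P_n) < \mathrm{twr}_{t-2}(c\,n^{2k})$.
   Context: For $k\ge 2$, the $k$-uniform tight path $P_n$ has vertices $v_1<\cdots<v_n$ and edges $\{v_j,\dots,v_{j+k-1}\}$ for $j=1,\dots,n-k+1$; in a red/blue coloring of the $k$-subsets of $[N]$, a blue copy of $P_n$ is a sequence $x_1<\cdots<x_n$ in $[N]$ with every $k$-set $\{x_j,\dots,x_{j+k-1}\}$ blue. For integers $2\le k<s<n$ and $1\le t\le\binom{s}{k}$, $r_k(s,t;P_n)$ is the minimum $N$ such that every red/blue coloring of the $k$-subsets of $[N]$ contains a blue copy of $P_n$ or a set of $s$ vertices containing at least $t$ red $k$-subsets. The tower function: $\mathrm{twr}_1(x)=x$, $\mathrm{twr}_{i+1}(x)=2^{\mathrm{twr}_i(x)}$. -}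

module Defs where

open import Data.Nat using (ℕ; zero; suc; _+_; _*_; _^_; _≤_; _<_)
open import Data.Fin using (Fin; toℕ)
open import Data.Fin.Subset using (Subset; _∈_; _⊆_; ∣_∣)
open import Data.Bool using (Bool; true; false)
open import Data.List using (List; length)
open import Data.List.Relation.Unary.All using (All)
open import Data.List.Relation.Unary.Unique.Propositional using (Unique)
open import Data.Product using (Σ; _×_; ∃; ∃-syntax)
open import Data.Sum using (_⊎_)
open import Relation.Binary.PropositionalEquality using (_≡_)
open import Function.Bundles using (_⇔_)

-- Tower function: twr 1 x = x, twr (i+1) x = 2 ^ twr i x.
-- (twr 0 x = x is an arbitrary convention; never used in the statement.)
twr : ℕ → ℕ → ℕ
twr zero x = x
twr (suc zero) x = x
twr (suc (suc i)) x = 2 ^ twr (suc i) x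

-- A red/blue coloring of the subsets of [N] (only values on k-subsets matter).
-- true = red, false = blue.
Coloring : ℕ → Set
Coloring N = Subset N → Bool

red blue : Bool
red = true
blue = false

Window : ∀ {N n} → ℕ → (Fin n → Fin N) → ℕ → Subset N → Set
Window k x j T = ∀ y → (y ∈ T) ⇔ (∃[ i ] (j ≤ toℕ i × toℕ i < j + k × x i ≡ y))

StrictlyIncreasing : ∀ {N n} → (Fin n → Fin N) → Set
StrictlyIncreasing x = ∀ i i' → toℕ i < toℕ i' → toℕ (x i) < toℕ (x i')

BluePath : ∀ {N} → ℕ → Coloring N → ℕ → Set
BluePath {N} k χ n =
  Σ (Fin n → Fin N) λ x → StrictlyIncreasing x ×
    (∀ j → j + k ≤ n → ∀ T → Window k x j T → χ T ≡ blue)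

RedDense : ∀ {N} → ℕ → Coloring N → ℕ → ℕ → Set
RedDense {N} k χ s t =
  Σ (Subset N) λ S → ∣ S ∣ ≡ s ×
    Σ (List (Subset N)) λ L → t ≤ length L × Unique L ×
      All (λ T → T ⊆ S × ∣ T ∣ ≡ k × χ T ≡ red) L

Arrows : ℕ → ℕ → ℕ → ℕ → ℕ → Set
Arrows k s t n N = (χ : Coloring N) → BluePath k χ n ⊎ RedDense k χ s t

-- r_k(s,t;P_n) < M  iff  some N < M has the property (r is the minimum such N).
RamseyLT : ℕ → ℕ → ℕ → ℕ → ℕ → Set
RamseyLT k s t n M = ∃[ N ] (N < M × Arrows k s t n N)

{-# OPTIONS --safe #-}
module Submission where

-- For t = 3 climb along blue paths: keep a blue path π together with d + 1 later points, each of which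
-- extends π.  Let t be the first of them.  If each other one s makes the last k vertices of π, t, s blue,
-- append t to π and go on with the others.  Otherwise some u is red, and fresh points z are tested against
-- both t and u.  Either d + 1 of them extend (π, t) or (π, u), or some z is red with both; then
-- e ∪ {t, u}, e ∪ {t, z}, e ∪ {u, z} are red, where e consists of the last k − 2 vertices of π.  A round
-- costs 2d + 1 fresh points, so O(n²) points suffice.
-- For larger t, apply the Erdős–Rado argument t − 3 times, at the price of one exponential each, until the
-- colour of a k-set depends on its first k − t + 3 vertices only.  Climb with respect to these.  Adding
-- t − 3 points above the red configuration gives t − 3 further red sets, one for each added point removed.

open import Defs
open import Data.Bool using (Bool; true; false)
open import Data.Fin as Fin using (Fin; toℕ; opposite)
import Data.Fin.Properties as Fin
open import Data.Fin.Subset as Subset using (Subset; ⁅_⁆; _∪_; ∣_∣; inside; outside)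
import Data.Fin.Subset.Properties as Subset
open import Data.List
  using (List; []; _∷_; _++_; _ʳ++_; length; reverse; take; drop; map; lookup; allFin)
open import Data.List.Membership.Propositional using (_∈_; _∉_)
open import Data.List.Membership.Propositional.Properties using (∈-lookup)
open import Data.List.Properties
  using (++-assoc; length-++; length-map; length-take; length-drop; length-reverse; length-tabulate;
         take-[]; take++drop≡id; drop-drop; ʳ++-defn; reverse-involutive)
open import Data.List.Relation.Binary.Sublist.Propositional as Sub
  using (_⊆_; []; _∷_; _∷ʳ_; ⊆-refl; ⊆-reflexive; ⊆-trans; minimum)
open import Data.List.Relation.Binary.Sublist.Propositional.Properties
  using (++⁺; ++⁺ˡ; ++⁺ʳ; ʳ++⁺; reverse⁺; reverse⁻; All-resp-⊆)
open import Data.List.Relation.Unary.All as All using (All; []; _∷_)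
import Data.List.Relation.Unary.All.Properties as All
open import Data.List.Relation.Unary.AllPairs as AllPairs using (AllPairs; []; _∷_)
import Data.List.Relation.Unary.AllPairs.Properties as AllPairs
open import Data.List.Relation.Unary.Any using (here; there)
open import Data.List.Relation.Unary.Unique.Propositional using (Unique)
open import Data.Nat
open import Data.Nat.Properties
open import Data.Product using (Σ; _×_; _,_; ∃-syntax; proj₁)
open import Data.Sum using (_⊎_; inj₁; inj₂)
import Data.Vec as Vec
open import Function using (_∘_; flip)
open import Function.Bundles using (Equivalence)
open import Relation.Binary.PropositionalEquality
open import Relation.Nullary using (yes; no; contradiction)

-- Sets of points are represented by descending lists, pools of candidates by ascending ones; the order
-- "P below S" is expressed by embedding P ʳ++ S into a fixed ascending list.
-- After the Erdős–Rado steps the uniformity k − t + 3 is written h + 2, with e = t − 3 steps.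

module _ {A : Set} where

  split : (φ : A → Bool) (S : List A) →
    ∃[ U ] ∃[ W ] U ⊆ S × W ⊆ S × All (λ s → φ s ≡ true) U × All (λ s → φ s ≡ false) W ×
      length U + length W ≡ length S
  split φ [] = [] , [] , [] , [] , [] , [] , refl
  split φ (s ∷ S) with split φ S | φ s in eq
  ... | U , W , U⊆ , W⊆ , u , w , e | true =
    s ∷ U , W , refl ∷ U⊆ , s ∷ʳ W⊆ , eq ∷ u , w , cong suc e
  ... | U , W , U⊆ , W⊆ , u , w , e | false =
    U , s ∷ W , s ∷ʳ U⊆ , refl ∷ W⊆ , u , eq ∷ w , trans (+-suc (length U) (length W)) (cong suc e)

  Constant : (A → Bool) → List A → Set
  Constant φ S = ∀ {s s'} → s ∈ S → s' ∈ S → φ s ≡ φ s'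

  All-≡⇒Constant : ∀ {φ : A → Bool} {b S} → All (λ s → φ s ≡ b) S → Constant φ S
  All-≡⇒Constant p s∈S s'∈S = trans (All.lookup p s∈S) (sym (All.lookup p s'∈S))

  majority : ∀ (φ : A → Bool) b S → 2 * b ≤ length S →
    ∃[ S' ] S' ⊆ S × b ≤ length S' × Constant φ S'
  majority φ b S 2b≤S with split φ S
  ... | U , W , U⊆S , W⊆S , u , w , eq with b ≤? length U
  ...   | yes b≤U = U , U⊆S , b≤U , All-≡⇒Constant u
  ...   | no b≰U = W , W⊆S , ≮⇒≥ W≮b , All-≡⇒Constant w
    where
    W≮b : length W ≮ b
    W≮b W<b = <-irrefl refl (begin-strict
      length S             ≡⟨ eq ⟨
      length U + length W  <⟨ +-mono-< (≰⇒> b≰U) W<b ⟩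
      b + b                ≡⟨ cong (b +_) (+-identityʳ b) ⟨
      2 * b                ≤⟨ 2b≤S ⟩
      length S             ∎)
      where open ≤-Reasoning

  -- One halving by `majority` for each `i`-point sublist of `P`. Their number is at most
  -- `suc (length P) ^ i` by Pascal's rule: with `q = suc (length P)`, the sublists that contain `x`
  -- and those that avoid it cost `q ^ i + q ^ suc i = suc q * q ^ i`, which is at most
  -- `suc q ^ suc i`.
  uniformize : ∀ i P (φ : List A → A → Bool) b S → 2 ^ (suc (length P) ^ i) * b ≤ length S →
    ∃[ S' ] S' ⊆ S × b ≤ length S' ×
      (∀ {zs} → zs ⊆ P → length zs ≡ i → Constant (φ zs) S')
  uniformize zero P φ b S h with majority (φ []) b S h
  ... | S' , S'⊆S , b≤S' , c = S' , S'⊆S , b≤S' , λ { {[]} _ _ → c }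
  uniformize (suc i) [] φ b S h =
    S , ⊆-refl , ≤-trans (m≤n*m b (2 ^ (1 ^ suc i)) {{m^n≢0 2 (1 ^ suc i)}}) h , λ { [] () }
  uniformize (suc i) (x ∷ P) φ b S h with uniformize i P (φ ∘ (x ∷_)) (2 ^ q ^ suc i * b) S bound
    where
    open ≤-Reasoning
    q = suc (length P)
    bound : 2 ^ q ^ i * (2 ^ q ^ suc i * b) ≤ length S
    bound = begin
      2 ^ q ^ i * (2 ^ q ^ suc i * b)  ≡⟨ *-assoc (2 ^ q ^ i) (2 ^ q ^ suc i) b ⟨
      2 ^ q ^ i * 2 ^ q ^ suc i * b    ≡⟨ cong (_* b) (^-distribˡ-+-* 2 (q ^ i) (q ^ suc i)) ⟨
      2 ^ (suc q * q ^ i) * b          ≤⟨ *-monoˡ-≤ b (^-monoʳ-≤ 2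
                                           (*-monoʳ-≤ (suc q) (^-monoˡ-≤ i (n≤1+n q)))) ⟩
      2 ^ suc q ^ suc i * b            ≤⟨ h ⟩
      length S                         ∎
  ... | S₁ , S₁⊆S , h₁ , c₁ with uniformize (suc i) P φ b S₁ h₁
  ...   | S₂ , S₂⊆S₁ , h₂ , c₂ = S₂ , ⊆-trans S₂⊆S₁ S₁⊆S , h₂ , c
    where
    c : ∀ {zs} → zs ⊆ x ∷ P → length zs ≡ suc i → Constant (φ zs) S₂
    c (.x ∷ʳ zs⊆P) l = c₂ zs⊆P l
    c (refl ∷ zs⊆P) l s∈ s'∈ =
      c₁ zs⊆P (suc-injective l) (Sub.lookup S₂⊆S₁ s∈) (Sub.lookup S₂⊆S₁ s'∈)

  -- The Erdős–Rado invariant of a chosen list P and the remaining pool S.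
  record EndHomogeneous (C : List A → Bool) (j : ℕ) (P S : List A) : Set where
    field
      top-irrelevant : ∀ {a ys s} → a ∷ ys ⊆ P → length ys ≡ j → s ∈ S → C (a ∷ ys) ≡ C (s ∷ ys)
      pool-constant  : ∀ {ys} → ys ⊆ P → length ys ≡ j → Constant (λ s → C (s ∷ ys)) S

  open EndHomogeneous

  -- Each round moves the first pool point `x` to `P` and makes the pool uniform for the sublists
  -- with head `x`. This costs a factor `2 ^ suc (M ^ i)`: at most `M ^ i` halvings, and one more to
  -- pay for `x` itself. The surviving pool point `ω` then stands for every possible top point.
  grow : ∀ M i (C : List A → Bool) m P S → EndHomogeneous C (suc i) P S → length P + m ≤ M →
    2 ^ (m * suc (M ^ i)) ≤ length S →
    ∃[ Q ] ∃[ ω ] length Q ≡ length P + m ×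
      reverse Q ⊆ P ʳ++ S × EndHomogeneous C (suc i) Q (ω ∷ [])
  grow M i C m P [] _ _ h = contradiction h (<⇒≱ (m^n>0 2 (m * suc (M ^ i))))
  grow M i C zero P (x ∷ S) H _ _ =
    P , x , sym (+-identityʳ _) , ʳ++⁺ (⊆-refl {x = P}) (minimum (x ∷ S)) ,
    record { top-irrelevant = λ { q l (here refl) → top-irrelevant H q l (here refl) }
           ; pool-constant = λ { q l (here refl) (here refl) → refl } }
  grow M i C (suc m) P (x ∷ S) H P≤M h
    with uniformize i P (λ zs s → C (s ∷ x ∷ zs)) b S bound
    where
    open ≤-Reasoning
    b = 2 ^ (m * suc (M ^ i))
    r = 2 ^ (M ^ i)
    halve : ∀ {y s} → 1 ≤ y → 2 * y ≤ suc s → y ≤ s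
    halve {suc y} {s} _ (s≤s le) = ≤-trans (m≤n+m (suc y) y)
      (≤-trans (≤-reflexive (cong (λ z → y + suc z) (sym (+-identityʳ y)))) le)
    P<M : suc (length P) ≤ M
    P<M = ≤-trans (s≤s (m≤m+n (length P) m))
      (≤-trans (≤-reflexive (sym (+-suc (length P) m))) P≤M)
    twice : 2 * (r * b) ≤ suc (length S)
    twice = begin
      2 * (r * b)                          ≡⟨ *-assoc 2 r b ⟨
      2 ^ suc (M ^ i) * b                  ≡⟨ ^-distribˡ-+-* 2 (suc (M ^ i)) (m * suc (M ^ i)) ⟨
      2 ^ (suc m * suc (M ^ i))            ≤⟨ h ⟩
      suc (length S)                       ∎
    bound : 2 ^ (suc (length P) ^ i) * b ≤ length S
    bound = begin
      2 ^ (suc (length P) ^ i) * b  ≤⟨ *-monoˡ-≤ b (^-monoʳ-≤ 2 (^-monoˡ-≤ i P<M)) ⟩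
      r * b                         ≤⟨ halve (*-mono-≤ (m^n>0 2 (M ^ i)) (m^n>0 2 (m * suc (M ^ i))))
                                             twice ⟩
      length S                      ∎
  ... | S' , S'⊆S , h' , c
    with grow M i C m (x ∷ P) S' H' (≤-trans (≤-reflexive (sym (+-suc (length P) m))) P≤M) h'
    where
    H' : EndHomogeneous C (suc i) (x ∷ P) S'
    H' .top-irrelevant (.x ∷ʳ q) l s∈S' = top-irrelevant H q l (there (Sub.lookup S'⊆S s∈S'))
    -- `x` was in the pool until now, so as a top point it is interchangeable with every remaining
    -- pool point.
    H' .top-irrelevant (refl ∷ q) l s∈S' = pool-constant H q l (here refl) (there (Sub.lookup S'⊆S s∈S'))
    H' .pool-constant (.x ∷ʳ q) l s∈ s'∈ =
      pool-constant H q l (there (Sub.lookup S'⊆S s∈)) (there (Sub.lookup S'⊆S s'∈))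
    H' .pool-constant (refl ∷ q) l s∈ s'∈ = c q (suc-injective l) s∈ s'∈
  ...   | Q , ω , l , Q⊆ , H″ =
    Q , ω , trans l (sym (+-suc (length P) m)) ,
    ⊆-trans Q⊆ (ʳ++⁺ (⊆-refl {x = x ∷ P}) S'⊆S) , H″

-- Points that suffice for `e` reductions leaving `M` points. To keep `m` points, `grow` asks for
-- `2 ^ (m * suc (m ^ i))` of them with `2 + i` at most `k`, and `m ^ k` bounds this exponent.
poolSize : ℕ → ℕ → ℕ → ℕ
poolSize k M zero = M
poolSize k M (suc e) = 2 ^ (poolSize k M e ^ k)

poolSize>1 : ∀ k M e → 2 ≤ M → 2 ≤ poolSize k M e
poolSize>1 k M zero h = h
poolSize>1 k M (suc e) h = ^-monoʳ-≤ 2 {1} (m^n>0 m {{>-nonZero (<⇒≤ (poolSize>1 k M e h))}} k)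
  where m = poolSize k M e

m*[1+m^i]≤m^k : ∀ {m i k} → 2 ≤ m → 2 + i ≤ k → m * suc (m ^ i) ≤ m ^ k
m*[1+m^i]≤m^k {m} {i} {k} 2≤m 2+i≤k = begin
  m * suc (m ^ i)        ≤⟨ *-monoʳ-≤ m (+-monoˡ-≤ (m ^ i) (m^n>0 m i)) ⟩
  m * (m ^ i + m ^ i)    ≡⟨ cong (λ x → m * (m ^ i + x)) (+-identityʳ (m ^ i)) ⟨
  m * (2 * m ^ i)        ≤⟨ *-monoʳ-≤ m (*-monoˡ-≤ (m ^ i) 2≤m) ⟩
  m ^ (2 + i)            ≤⟨ ^-monoʳ-≤ m 2+i≤k ⟩
  m ^ k                  ∎
  where
  open ≤-Reasoning
  instance
    m≢0 : NonZero m
    m≢0 = >-nonZero (<⇒≤ 2≤m)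

module _ {A : Set} where
  open EndHomogeneous

  -- After `grow`, the top point of a set may be replaced by `ω` without changing the colour. So
  -- `λ ys → C (ω ∷ ys)` colours sets with one point fewer, and the induction continues with it on
  -- the chosen points. As lists are descending, `as` consists of the `e` largest points of the set.
  stepDown : ∀ h e k M → suc (suc h) + e ≤ k → 2 ≤ M → (C : List A → Bool) (V : List A) →
    poolSize k M e ≤ length V →
    ∃[ P ] Σ (List A → Bool) λ D → M ≤ length P × reverse P ⊆ V ×
      (∀ as ys → length as ≡ e → length ys ≡ suc (suc h) → as ++ ys ⊆ P → C (as ++ ys) ≡ D ys)
  stepDown h zero k M _ _ C V M≤V =
    reverse V , C , ≤-trans M≤V (≤-reflexive (sym (length-reverse V))) ,
    ⊆-reflexive (reverse-involutive V) , λ { [] ys _ _ _ → refl }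
  stepDown h (suc e) k M K≤k 2≤M C V big
    with grow m (suc h + e) C m [] V
           (record { top-irrelevant = λ () ; pool-constant = λ { [] () } }) ≤-refl
           (≤-trans (^-monoʳ-≤ 2 (m*[1+m^i]≤m^k (poolSize>1 k M e 2≤M)
             (≤-trans (≤-reflexive (cong (suc ∘ suc) (sym (+-suc h e)))) K≤k))) big)
    where m = poolSize k M e
  ... | Q , ω , l , Q⊆V , H
    with stepDown h e k M (≤-trans (+-monoʳ-≤ (suc (suc h)) (n≤1+n e)) K≤k) 2≤M
           (λ ys → C (ω ∷ ys)) (reverse Q) (≤-reflexive (sym (trans (length-reverse Q) l)))
  ...   | P , D , M≤P , P⊆Q , determined = P , D , M≤P , ⊆-trans P⊆Q Q⊆V , determined'
    where
    determined' : ∀ as ys →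
      length as ≡ suc e → length ys ≡ suc (suc h) → as ++ ys ⊆ P → C (as ++ ys) ≡ D ys
    determined' (a ∷ as) ys la ly q = trans
      (top-irrelevant H (⊆-trans q (reverse⁻ P⊆Q))
        (trans (length-++ as) (trans (cong₂ _+_ (suc-injective la) ly) (+-comm e (suc (suc h))))) (here refl))
      (determined as ys (suc-injective la) ly (⊆-trans (a ∷ʳ ⊆-refl) q))

  -- Climbing along blue paths.

  data Path (h : ℕ) (D : List A → Bool) : List A → Set where
    -- At most `h + 1` points hold no complete window; the climb starts from such lists.
    short  : ∀ {π} → length π ≤ suc h → Path h D π
    extend : ∀ {x π} → D (take (suc (suc h)) (x ∷ π)) ≡ false → Path h D π → Path h D (x ∷ π)

  LongPath : ℕ → (List A → Bool) → List A → ℕ → Set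
  LongPath h D V n = ∃[ ρ ] length ρ ≡ n × Path h D ρ × reverse ρ ⊆ V

  -- Together with the last `h` vertices of the path, the three pairs from `t`, `u`, `z` form three
  -- red sets among `h + 3` points; `long` guarantees that the windows are full.
  record RedTriple (h : ℕ) (D : List A → Bool) (V : List A) : Set where
    constructor redTriple
    field
      {π}    : List A
      {t u z} : A
      long   : h ≤ length π
      sorted : reverse (z ∷ u ∷ t ∷ π) ⊆ V
      red-ut : D (take (suc (suc h)) (u ∷ t ∷ π)) ≡ true
      red-zt : D (take (suc (suc h)) (z ∷ t ∷ π)) ≡ true
      red-zu : D (take (suc (suc h)) (z ∷ u ∷ π)) ≡ true

  -- The rounds use 1 + 3 + ⋯ + (2d − 1) = d² points of Z.
  climb : ∀ h D V d π T Z → h ≤ length π → d < length T → d * d ≤ length Z →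
    All (λ t → Path h D (t ∷ π)) T → π ʳ++ (T ++ Z) ⊆ V →
    LongPath h D V (suc d + length π) ⊎ RedTriple h D V
  climb h D V zero π (t ∷ T) Z _ _ _ (p ∷ _) ⊆V =
    inj₁ (t ∷ π , refl , p , ⊆-trans (ʳ++⁺ (⊆-refl {x = t ∷ π}) (minimum (T ++ Z))) ⊆V)
  climb h D V (suc d) π (t ∷ T) Z h≤π (s≤s d<T) d²≤Z (p ∷ ps) ⊆V = byT (split (color t) T)
    where
    color : A → A → Bool
    color x s = D (take (suc (suc h)) (s ∷ x ∷ π))

    -- Pigeonhole: if at most `d` of `2d + 1` test points are blue with `t`, then more than `d` are
    -- red with it.
    Z₁ Z₂ : List A
    Z₁ = take (suc (d + d)) Z
    Z₂ = drop (suc (d + d)) Z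

    Z₁++Z₂ : Z₁ ++ Z₂ ≡ Z
    Z₁++Z₂ = take++drop≡id (suc (d + d)) Z

    split-square : suc (d + d) + d * d ≡ suc d * suc d
    split-square = cong suc (begin
      (d + d) + d * d  ≡⟨ +-assoc d d (d * d) ⟩
      d + (d + d * d)  ≡⟨ cong (d +_) (*-suc d d) ⟨
      d + d * suc d    ∎)
      where open ≡-Reasoning

    Z₁-length : length Z₁ ≡ suc (d + d)
    Z₁-length = trans (length-take (suc (d + d)) Z)
      (m≤n⇒m⊓n≡m (≤-trans (m≤m+n _ (d * d)) (≤-trans (≤-reflexive split-square) d²≤Z)))

    Z₂-length : d * d ≤ length Z₂
    Z₂-length = begin
      d * d                                      ≡⟨ m+n∸m≡n (suc (d + d)) (d * d) ⟨
      suc (d + d) + d * d ∸ suc (d + d)          ≡⟨ cong (_∸ suc (d + d)) split-square ⟩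
      suc d * suc d ∸ suc (d + d)                ≤⟨ ∸-monoˡ-≤ (suc (d + d)) d²≤Z ⟩
      length Z ∸ suc (d + d)                     ≡⟨ length-drop (suc (d + d)) Z ⟨
      length Z₂                                  ∎
      where open ≤-Reasoning

    -- The three ways to go on share this step: `x` becomes the next vertex and `W` the new list of
    -- candidates. Here `x` is `t` in two of the cases and `u` in the third.
    advance : ∀ x W Z' → Path h D (x ∷ π) → All (λ s → color x s ≡ false) W → d < length W →
      d * d ≤ length Z' → x ∷ W ++ Z' ⊆ t ∷ T ++ Z →
      LongPath h D V (suc (suc d) + length π) ⊎ RedTriple h D V
    advance x W Z' px blue d<W d²≤Z' sub =
      subst (λ n → LongPath h D V n ⊎ RedTriple h D V) (cong suc (+-suc d (length π)))
        (climb h D V d (x ∷ π) W Z' (≤-trans h≤π (n≤1+n _)) d<W d²≤Z'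
          (All.map (λ b → extend b px) blue)
          (⊆-trans (ʳ++⁺ (⊆-refl {x = π}) sub) ⊆V))

    in-Z : ∀ {W} → W ⊆ Z₁ → W ++ Z₂ ⊆ Z
    in-Z W⊆ = ⊆-trans (++⁺ W⊆ ⊆-refl) (⊆-reflexive Z₁++Z₂)

    byT : (∃[ U ] ∃[ W ] U ⊆ T × W ⊆ T × All (λ s → color t s ≡ true) U ×
             All (λ s → color t s ≡ false) W × length U + length W ≡ length T) →
      LongPath h D V (suc (suc d) + length π) ⊎ RedTriple h D V
    -- No candidate is red with `t`: the rest of `T` suffices and no point of `Z` is spent.
    byT ([] , W , _ , W⊆T , _ , blue , l) =
      advance t W Z p blue (≤-trans d<T (≤-reflexive (sym l)))
        (≤-trans (*-mono-≤ (n≤1+n d) (n≤1+n d)) d²≤Z)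
        (refl ∷ ++⁺ W⊆T ⊆-refl)
    byT (u ∷ _ , _ , u∷⊆T , _ , red-ut ∷ _ , _ , _) = byZ (split (color t) Z₁)
      where
      [u]⊆T : u ∷ [] ⊆ T
      [u]⊆T = ⊆-trans (refl ∷ minimum _) u∷⊆T

      byZ : (∃[ U ] ∃[ W ] U ⊆ Z₁ × W ⊆ Z₁ × All (λ s → color t s ≡ true) U ×
               All (λ s → color t s ≡ false) W × length U + length W ≡ length Z₁) →
        LongPath h D V (suc (suc d) + length π) ⊎ RedTriple h D V
      byZ (U , W , U⊆Z₁ , W⊆Z₁ , red , blue , l) with d <? length W
      ... | yes d<W = advance t W Z₂ p blue d<W Z₂-length (refl ∷ ++⁺ˡ T (in-Z W⊆Z₁))
      ... | no d≮W = again (split (color u) U)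
        where
        d<U : d < length U
        d<U = +-cancelʳ-< d d (length U) (begin-strict
          d + d                <⟨ n<1+n _ ⟩
          suc (d + d)          ≡⟨ Z₁-length ⟨
          length Z₁            ≡⟨ l ⟨
          length U + length W  ≤⟨ +-monoʳ-≤ (length U) (≮⇒≥ d≮W) ⟩
          length U + d         ∎)
          where open ≤-Reasoning
        pu : Path h D (u ∷ π)
        pu = All.lookup ps (Sub.lookup u∷⊆T (here refl))
        again : (∃[ X ] ∃[ Y ] X ⊆ U × Y ⊆ U × All (λ s → color u s ≡ true) X ×
                   All (λ s → color u s ≡ false) Y × length X + length Y ≡ length U) →
          LongPath h D V (suc (suc d) + length π) ⊎ RedTriple h D V
        -- `u` takes the place of `t` as next vertex, which is possible because every candidate in
        -- `T` extends `π`.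
        again ([] , Y , _ , Y⊆U , _ , blue' , l') =
          advance u Y Z₂ pu blue' (≤-trans d<U (≤-reflexive (sym l'))) Z₂-length
            (t ∷ʳ ++⁺ [u]⊆T (in-Z (⊆-trans Y⊆U U⊆Z₁)))
        -- `z` comes from `U`, so it is red with `t` as well as with `u`.
        again (z ∷ _ , _ , z∷⊆U , _ , red-zu ∷ _ , _ , _) = inj₂ (redTriple h≤π
          (⊆-trans (ʳ++⁺ (⊆-refl {x = π})
            (refl ∷ ++⁺ [u]⊆T (⊆-trans (refl ∷ minimum _) (in-Z (⊆-trans z∷⊆U U⊆Z₁))))) ⊆V)
          red-ut (All.lookup red (Sub.lookup z∷⊆U (here refl))) red-zu)

-- Lists as subsets.

module _ {N : ℕ} where

  fromList : List (Fin N) → Subset N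
  fromList [] = Subset.⊥
  fromList (x ∷ xs) = ⁅ x ⁆ ∪ fromList xs

  ∈-fromList⁺ : ∀ {y xs} → y ∈ xs → y Subset.∈ fromList xs
  ∈-fromList⁺ (here refl) = Subset.x∈p∪q⁺ (inj₁ (Subset.x∈⁅x⁆ _))
  ∈-fromList⁺ (there y∈xs) = Subset.x∈p∪q⁺ (inj₂ (∈-fromList⁺ y∈xs))

  ∈-fromList⁻ : ∀ {y} xs → y Subset.∈ fromList xs → y ∈ xs
  ∈-fromList⁻ [] y∈⊥ = contradiction y∈⊥ Subset.∉⊥
  ∈-fromList⁻ (x ∷ xs) y∈ with Subset.x∈p∪q⁻ ⁅ x ⁆ (fromList xs) y∈
  ... | inj₁ y∈x = here (Subset.x∈⁅y⁆⇒x≡y x y∈x)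
  ... | inj₂ y∈xs = there (∈-fromList⁻ xs y∈xs)

∣⁅x⁆∪p∣ : ∀ {n} (x : Fin n) (p : Subset n) → x Subset.∉ p → ∣ ⁅ x ⁆ ∪ p ∣ ≡ suc ∣ p ∣
∣⁅x⁆∪p∣ Fin.zero (inside Vec.∷ p) x∉p = contradiction Vec.here x∉p
∣⁅x⁆∪p∣ Fin.zero (outside Vec.∷ p) x∉p = cong (suc ∘ ∣_∣) (Subset.∪-identityˡ p)
∣⁅x⁆∪p∣ (Fin.suc x) (inside Vec.∷ p) x∉p = cong suc (∣⁅x⁆∪p∣ x p (x∉p ∘ Vec.there))
∣⁅x⁆∪p∣ (Fin.suc x) (outside Vec.∷ p) x∉p = ∣⁅x⁆∪p∣ x p (x∉p ∘ Vec.there)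

∣fromList∣ : ∀ {N} {xs : List (Fin N)} → Unique xs → ∣ fromList xs ∣ ≡ length xs
∣fromList∣ {N} [] = Subset.∣⊥∣≡0 N
∣fromList∣ {xs = x ∷ xs} (x≢ ∷ u) = trans
  (∣⁅x⁆∪p∣ x (fromList xs) (λ x∈ → All.lookup x≢ (∈-fromList⁻ xs x∈) refl))
  (cong suc (∣fromList∣ u))

AllPairs-resp-⊆ : ∀ {A : Set} {R : A → A → Set} {xs ys} → xs ⊆ ys → AllPairs R ys → AllPairs R xs
AllPairs-resp-⊆ [] [] = []
AllPairs-resp-⊆ (_ ∷ʳ q) (_ ∷ rs) = AllPairs-resp-⊆ q rs
AllPairs-resp-⊆ (refl ∷ q) (r ∷ rs) = All-resp-⊆ q r ∷ AllPairs-resp-⊆ q rs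

-- Deleting one point from a list.

module _ {A : Set} where

  -- For a descending list of at least `m` points these are the subsets missing exactly one of the
  -- `m` largest; they serve as the red sets of `RedDense`.
  deletions : ℕ → List A → List (List A)
  deletions zero _ = []
  deletions (suc m) [] = []
  deletions (suc m) (x ∷ xs) = xs ∷ map (x ∷_) (deletions m xs)

  length-deletions : ∀ m xs → m ≤ length xs → length (deletions m xs) ≡ m
  length-deletions zero xs _ = refl
  length-deletions (suc m) (x ∷ xs) (s≤s m≤) =
    cong suc (trans (length-map (x ∷_) (deletions m xs)) (length-deletions m xs m≤))

  deletions-⊆ : ∀ m xs → All (λ ys → ys ⊆ xs × suc (length ys) ≡ length xs) (deletions m xs)
  deletions-⊆ zero xs = []
  deletions-⊆ (suc m) [] = []
  deletions-⊆ (suc m) (x ∷ xs) = (x ∷ʳ ⊆-refl , refl) ∷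
    All.map⁺ (All.map (λ (q , l) → refl ∷ q , cong suc l) (deletions-⊆ m xs))

  -- A point witnesses the difference, rather than inequality of lists: it still tells the sets
  -- apart once `fromList` forgets order and repetition.
  Separated : List A → List A → Set
  Separated us vs = ∃[ w ] w ∈ vs × w ∉ us

  -- The first deletion lacks `x`, which all later ones keep; these are compared by induction.
  deletions-separated : ∀ m {xs} → Unique xs → AllPairs Separated (deletions m xs)
  deletions-separated zero _ = []
  deletions-separated (suc m) [] = []
  deletions-separated (suc m) {x ∷ xs} (x≢ ∷ u) =
    All.map⁺ (All.universal (λ ys → x , here refl , λ x∈ → All.lookup x≢ x∈ refl) _) ∷
    AllPairs.map⁺ (raise (All.map proj₁ (deletions-⊆ m xs)) (deletions-separated m u))
    where
    raise₁ : ∀ {us L} → All (_⊆ xs) L → All (Separated us) L →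
      All (λ vs → Separated (x ∷ us) (x ∷ vs)) L
    raise₁ [] [] = []
    raise₁ (q ∷ qs) ((w , w∈ , w∉) ∷ r) =
      (w , there w∈ , λ { (here refl) → All.lookup x≢ (Sub.lookup q w∈) refl
                        ; (there w∈us) → w∉ w∈us })
      ∷ raise₁ qs r
    raise : ∀ {L} → All (_⊆ xs) L → AllPairs Separated L →
      AllPairs (λ us vs → Separated (x ∷ us) (x ∷ vs)) L
    raise [] [] = []
    raise (_ ∷ qs) (r ∷ rs) = raise₁ qs r ∷ raise qs rs

  -- The shape of the final configuration: `W` holds the points placed on top and `a`, `b`, `c` are
  -- those of a red triple, so a deletion falls either inside `W` or on one of these three.
  deletions-++ : ∀ {Q : List A → Set} W {a b c R} →
    (∀ {W'} → W' ⊆ W → suc (length W') ≡ length W → Q (W' ++ a ∷ b ∷ c ∷ R)) →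
    Q (W ++ b ∷ c ∷ R) → Q (W ++ a ∷ c ∷ R) → Q (W ++ a ∷ b ∷ R) →
    All Q (deletions (length W + 3) (W ++ a ∷ b ∷ c ∷ R))
  deletions-++ [] _ qa qb qc = qa ∷ qb ∷ qc ∷ []
  deletions-++ (w ∷ W) q qa qb qc = q (w ∷ʳ ⊆-refl) refl ∷
    All.map⁺ (deletions-++ W (λ W'⊆W l → q (refl ∷ W'⊆W) (cong suc l)) qa qb qc)

  -- Windows and order in lists.

  lookup-window : ∀ m k (ρ : List A) {y} → y ∈ take k (drop m ρ) →
    ∃[ p ] m ≤ toℕ p × toℕ p < m + k × lookup ρ p ≡ y
  lookup-window zero (suc k) (x ∷ ρ) (here refl) = Fin.zero , z≤n , z<s , refl
  lookup-window zero (suc k) (x ∷ ρ) (there y∈) with lookup-window zero k ρ y∈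
  ... | p , _ , p<k , eq = Fin.suc p , z≤n , s≤s p<k , eq
  lookup-window zero (suc k) [] ()
  lookup-window (suc m) k [] y∈ with () ← subst (_ ∈_) (take-[] k) y∈
  lookup-window (suc m) k (x ∷ ρ) y∈ with lookup-window m k ρ y∈
  ... | p , m≤p , p<m+k , eq = Fin.suc p , s≤s m≤p , s≤s p<m+k , eq

  window-lookup : ∀ m k (ρ : List A) p → m ≤ toℕ p → toℕ p < m + k → lookup ρ p ∈ take k (drop m ρ)
  window-lookup zero (suc k) (x ∷ ρ) Fin.zero _ _ = here refl
  window-lookup zero (suc k) (x ∷ ρ) (Fin.suc p) _ (s≤s p<k) = there (window-lookup zero k ρ p z≤n p<k)
  window-lookup (suc m) k (x ∷ ρ) (Fin.suc p) (s≤s m≤p) (s≤s p<m+k) = window-lookup m k ρ p m≤p p<m+k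

  AllPairs-lookup : ∀ {R : A → A → Set} {ρ} → AllPairs R ρ →
    ∀ p q → toℕ p < toℕ q → R (lookup ρ p) (lookup ρ q)
  AllPairs-lookup (r ∷ _) Fin.zero (Fin.suc q) _ = All.lookup r (∈-lookup q)
  AllPairs-lookup (_ ∷ rs) (Fin.suc p) (Fin.suc q) (s≤s p<q) = AllPairs-lookup rs p q p<q

  AllPairs-ʳ++ : ∀ {R : A → A → Set} {xs ys} → AllPairs R xs → AllPairs (flip R) ys →
    All (λ x → All (λ y → R y x) ys) xs → AllPairs (flip R) (xs ʳ++ ys)
  AllPairs-ʳ++ [] rys [] = rys
  AllPairs-ʳ++ (rx ∷ rxs) rys (ryx ∷ ryxs) =
    AllPairs-ʳ++ rxs (ryx ∷ rys) (All.zipWith (λ (r , rs) → r ∷ rs) (rx , ryxs))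

  take-+ : ∀ m n (xs : List A) → take (m + n) xs ≡ take m xs ++ take n (drop m xs)
  take-+ zero n xs = refl
  take-+ (suc m) n [] = sym (take-[] n)
  take-+ (suc m) n (x ∷ xs) = cong (x ∷_) (take-+ m n xs)

  take-drop-⊆ : ∀ k m (xs : List A) → take k (drop m xs) ⊆ xs
  take-drop-⊆ k m xs = ⊆-trans (prefix (drop m xs))
    (⊆-trans (++⁺ˡ (take m xs) ⊆-refl) (⊆-reflexive (take++drop≡id m xs)))
    where
    prefix : ∀ ys → take k ys ⊆ ys
    prefix ys = ⊆-trans (++⁺ʳ (drop k ys) ⊆-refl) (⊆-reflexive (take++drop≡id k ys))

  length-take-≤ : ∀ {m} (xs : List A) → m ≤ length xs → length (take m xs) ≡ m
  length-take-≤ {m} xs m≤ = trans (length-take m xs) (m≤n⇒m⊓n≡m m≤)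

  blue-window : ∀ {h D} {ρ : List A} → Path h D ρ → ∀ m → m + suc (suc h) ≤ length ρ →
    D (take (suc (suc h)) (drop m ρ)) ≡ false
  blue-window {h} (short ρ≤) m m≤ = contradiction (≤-trans (m≤n+m (suc (suc h)) m) m≤) (<⇒≱ (s≤s ρ≤))
  blue-window (extend b _) zero _ = b
  blue-window (extend _ p) (suc m) (s≤s m≤) = blue-window p m m≤

-- From lists back to blue paths and red-dense sets.

bluePath : ∀ {N} k (χ : Coloring N) ρ → AllPairs Fin._>_ ρ →
  (∀ m → m + k ≤ length ρ → χ (fromList (take k (drop m ρ))) ≡ false) → BluePath k χ (length ρ)
bluePath {N} k χ ρ desc blue = x , increasing , window
  where
  n = length ρ
  x : Fin n → Fin N
  x i = lookup ρ (opposite i)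
  increasing : StrictlyIncreasing x
  increasing i i' i<i' = AllPairs-lookup desc (opposite i') (opposite i)
    (subst₂ _<_ (sym (Fin.opposite-prop i')) (sym (Fin.opposite-prop i)) (∸-monoʳ-< (s≤s i<i') (Fin.toℕ<n i')))
  window : ∀ j → j + k ≤ n → ∀ T → Window k x j T → χ T ≡ false
  window j j+k≤n T w = subst (λ U → χ U ≡ false) (Subset.⊆-antisym ⊆T T⊆)
    (blue m (≤-trans (≤-reflexive m+k) (m∸n≤m n j)))
    where
    -- Positions `j` to `j + k - 1` of the path are positions `n - j - k` to `n - j - 1` of the
    -- descending list `ρ`.
    m = n ∸ (j + k)
    m+k : m + k ≡ n ∸ j
    m+k = trans (cong (_+ k) (sym (∸-+-assoc n j k)))
      (m∸n+n≡m (m+n≤o⇒m≤o∸n k (≤-trans (≤-reflexive (+-comm k j)) j+k≤n)))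
    T⊆ : T Subset.⊆ fromList (take k (drop m ρ))
    T⊆ {y} y∈T with Equivalence.to (w y) y∈T
    ... | i , j≤i , i<j+k , refl = ∈-fromList⁺ (window-lookup m k ρ (opposite i)
      (subst (m ≤_) (sym (Fin.opposite-prop i)) (∸-monoʳ-≤ n i<j+k))
      (subst₂ _<_ (sym (Fin.opposite-prop i)) (sym m+k) (∸-monoʳ-< (s≤s j≤i) (Fin.toℕ<n i))))
    ⊆T : fromList (take k (drop m ρ)) Subset.⊆ T
    ⊆T {y} y∈ with lookup-window m k ρ (∈-fromList⁻ (take k (drop m ρ)) y∈)
    ... | p , m≤p , p<m+k , refl = Equivalence.from (w y)
      (opposite p
      , subst (j ≤_) (sym (Fin.opposite-prop p)) (m+n≤o⇒m≤o∸n j (subst (_≤ n) (+-comm (suc (toℕ p)) j) p+j<n))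
      , subst (_< j + k) (sym (Fin.opposite-prop p)) n∸p<j+k
      , cong (lookup ρ) (Fin.opposite-involutive p))
      where
      open ≤-Reasoning
      p+j<n : suc (toℕ p) + j ≤ n
      p+j<n = begin
        suc (toℕ p) + j  ≤⟨ +-monoˡ-≤ j (≤-trans p<m+k (≤-reflexive m+k)) ⟩
        n ∸ j + j        ≡⟨ m∸n+n≡m (≤-trans (m≤m+n j k) j+k≤n) ⟩
        n                ∎
      n∸p<j+k : n ∸ suc (toℕ p) < j + k
      n∸p<j+k = begin-strict
        n ∸ suc (toℕ p)    <⟨ ∸-monoʳ-< (n<1+n (toℕ p)) (Fin.toℕ<n p) ⟩
        n ∸ toℕ p          ≤⟨ ∸-monoʳ-≤ n m≤p ⟩
        n ∸ (n ∸ (j + k))  ≡⟨ m∸[m∸n]≡n j+k≤n ⟩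
        j + k              ∎

-- The `t` sets are distinct by `Separated`, and each has `k` points because it lacks one of the
-- `k + 1` points of `xs`.
redDense : ∀ {N} k (χ : Coloring N) t (xs : List (Fin N)) → Unique xs → length xs ≡ suc k → t ≤ suc k →
  All (λ ys → χ (fromList ys) ≡ true) (deletions t xs) → RedDense k χ (k + 1) t
redDense k χ t xs u l t≤ red =
  fromList xs , trans (∣fromList∣ u) (trans l (+-comm 1 k)) ,
  map fromList (deletions t xs) ,
  ≤-reflexive (sym (trans (length-map fromList (deletions t xs))
    (length-deletions t xs (≤-trans t≤ (≤-reflexive (sym l)))))) ,
  AllPairs.map⁺ (AllPairs.map distinct (deletions-separated t u)) ,
  All.map⁺ (All.zipWith member (deletions-⊆ t xs , red))
  where
  distinct : ∀ {us vs} → Separated us vs → fromList us ≢ fromList vs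
  distinct {us} (w , w∈vs , w∉us) eq =
    w∉us (∈-fromList⁻ us (subst (w Subset.∈_) (sym eq) (∈-fromList⁺ w∈vs)))
  member : ∀ {ys} → (ys ⊆ xs × suc (length ys) ≡ length xs) × χ (fromList ys) ≡ true →
    fromList ys Subset.⊆ fromList xs × ∣ fromList ys ∣ ≡ k × χ (fromList ys) ≡ true
  member {ys} ((q , m) , r) =
    (λ y∈ → ∈-fromList⁺ (Sub.lookup q (∈-fromList⁻ ys y∈))) ,
    trans (∣fromList∣ (AllPairs-resp-⊆ q u)) (suc-injective (trans m l)) , r

-- Combining the reduction with the climb.

pathThreshold : ℕ → ℕ
pathThreshold n = 3 * (n * n)

arrows : ∀ h e n → suc (suc (h + e)) + 1 < n →
  let k = suc (suc (h + e)) in Arrows k (k + 1) (e + 3) n (poolSize k (pathThreshold n) e)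
arrows h e n k<n χ
  with stepDown h e k M ≤-refl 2≤M (χ ∘ fromList) (allFin N)
         (≤-reflexive (sym (length-tabulate {n = N} (λ i → i))))
  where
  k = suc (suc (h + e))
  M = pathThreshold n
  N = poolSize k M e
  1≤n : 1 ≤ n
  1≤n = ≤-trans (s≤s z≤n) k<n
  2≤M : 2 ≤ M
  2≤M = ≤-trans (n≤1+n 2) (*-monoʳ-≤ 3 (*-mono-≤ 1≤n 1≤n))
... | P , D , M≤P , P⊆V , determined = conclude (climb h D V d π T Z
        (≤-reflexive (sym π-length)) (≤-reflexive (sym T-length)) d²≤Z
        -- As `π` has only `h` vertices, adding any point of `T` gives a path too short to have a
        -- window.
        (All.universal (λ t → short (s≤s (≤-reflexive π-length))) T) whole)
  where
  k = suc (suc (h + e))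
  K = suc (suc h)
  k≡e+K : k ≡ e + K
  k≡e+K = +-comm K e
  M = pathThreshold n
  N = poolSize k M e
  -- The climb ends with `suc d + h` vertices, which is `n`.
  d = n ∸ suc h
  -- The `e` largest points are kept back, to be placed above a red triple.
  W = take e P
  P₀ = drop e P
  V = reverse P₀
  π = reverse (take h V)
  V₁ = drop h V
  T = take (suc d) V₁
  Z = drop (suc d) V₁

  h<n : suc h ≤ n
  h<n = ≤-trans (s≤s (≤-trans (m≤m+n h e) (≤-trans (n≤1+n _) (≤-trans (n≤1+n _) (m≤m+n k 1))))) k<n
  1+d+h : suc d + h ≡ n
  1+d+h = trans (sym (+-suc d h)) (m∸n+n≡m h<n)
  e≤n : e ≤ n
  e≤n = ≤-trans (m≤n+m e (suc (suc h))) (≤-trans (m≤m+n k 1) (<⇒≤ k<n))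
  d≤n : d ≤ n
  d≤n = m∸n≤m n (suc h)
  n≤n*n : n ≤ n * n
  n≤n*n = m≤m*n n n {{>-nonZero (≤-trans (s≤s z≤n) h<n)}}

  -- `pathThreshold` has one `n * n` for each of three parts: the `e` points of `W`, the
  -- `h + suc d = n` points of `π` and `T`, and the `d * d` points of `Z`.
  budget : e + (h + (suc d + d * d)) ≤ length P
  budget = begin
    e + (h + (suc d + d * d))  ≡⟨ cong (e +_) (+-assoc h (suc d) (d * d)) ⟨
    e + (h + suc d + d * d)    ≡⟨ cong (λ x → e + (x + d * d)) (trans (+-comm h (suc d)) 1+d+h) ⟩
    e + (n + d * d)            ≤⟨ +-mono-≤ (≤-trans e≤n n≤n*n) (+-mono-≤ n≤n*n (*-mono-≤ d≤n d≤n)) ⟩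
    n * n + (n * n + n * n)    ≡⟨ cong (λ x → n * n + (n * n + x)) (+-identityʳ (n * n)) ⟨
    M                          ≤⟨ M≤P ⟩
    length P                   ∎
    where open ≤-Reasoning

  drop-budget : ∀ {A : Set} m (xs : List A) {c} → m + c ≤ length xs → c ≤ length (drop m xs)
  drop-budget m xs {c} le = ≤-trans
    (m+n≤o⇒m≤o∸n c (≤-trans (≤-reflexive (+-comm c m)) le)) (≤-reflexive (sym (length-drop m xs)))

  V-budget : h + (suc d + d * d) ≤ length V
  V-budget = ≤-trans (drop-budget e P budget) (≤-reflexive (sym (length-reverse P₀)))
  V₁-budget : suc d + d * d ≤ length V₁
  V₁-budget = drop-budget h V V-budget
  d²≤Z : d * d ≤ length Z
  d²≤Z = drop-budget (suc d) V₁ V₁-budget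
  W-length : length W ≡ e
  W-length = length-take-≤ P (m+n≤o⇒m≤o e budget)
  π-length : length π ≡ h
  π-length = trans (length-reverse (take h V)) (length-take-≤ V (m+n≤o⇒m≤o h V-budget))
  T-length : length T ≡ suc d
  T-length = length-take-≤ V₁ (m+n≤o⇒m≤o (suc d) V₁-budget)

  whole : π ʳ++ (T ++ Z) ⊆ V
  whole = ⊆-reflexive (begin
    π ʳ++ (T ++ Z)          ≡⟨ ʳ++-defn π ⟩
    reverse π ++ (T ++ Z)   ≡⟨ cong₂ _++_ (reverse-involutive (take h V)) (take++drop≡id (suc d) V₁) ⟩
    take h V ++ V₁          ≡⟨ take++drop≡id h V ⟩
    V                       ∎)
    where open ≡-Reasoning

  P-descending : AllPairs Fin._>_ P
  P-descending = AllPairs-resp-⊆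
    (⊆-trans (⊆-reflexive (sym (reverse-involutive P))) (reverse⁺ P⊆V))
    (AllPairs-ʳ++ (AllPairs.tabulate⁺-< {f = λ (i : Fin N) → i} (λ i<j → i<j)) []
      (All.universal (λ _ → []) _))

  P₀⊆P : P₀ ⊆ P
  P₀⊆P = ⊆-trans (++⁺ˡ W ⊆-refl) (⊆-reflexive (take++drop≡id e P))

  W++⊆P : ∀ {Q} → Q ⊆ P₀ → W ++ Q ⊆ P
  W++⊆P q = ⊆-trans (++⁺ ⊆-refl q) (⊆-reflexive (take++drop≡id e P))

  conclude : LongPath h D V (suc d + length π) ⊎ RedTriple h D V →
    BluePath k χ n ⊎ RedDense k χ (k + 1) (e + 3)
  conclude (inj₁ (ρ , l , path , ρ⊆V)) = inj₁ (subst (BluePath k χ) ρ-length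
    (bluePath k χ ρ (AllPairs-resp-⊆ ρ⊆P P-descending) windows))
    where
    ρ-length : length ρ ≡ n
    ρ-length = trans l (trans (cong (suc d +_) π-length) 1+d+h)
    ρ⊆P : ρ ⊆ P
    ρ⊆P = ⊆-trans (reverse⁻ ρ⊆V) P₀⊆P
    -- The `e` largest points of a `k`-window do not affect its colour, and the others form a
    -- `K`-window of `ρ` that starts `e` places further on.
    windows : ∀ m → m + k ≤ length ρ → χ (fromList (take k (drop m ρ))) ≡ false
    windows m m+k≤ρ = begin
      χ (fromList (take k ρ'))                        ≡⟨ cong (χ ∘ fromList) window ⟩
      χ (fromList (take e ρ' ++ take K (drop e ρ')))  ≡⟨ determined _ _ W-size K-size inside-P ⟩
      D (take K (drop e ρ'))                          ≡⟨ cong (D ∘ take K) (drop-drop m e ρ) ⟩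
      D (take K (drop (m + e) ρ))                     ≡⟨ blue-window path (m + e) m+e+K≤ρ ⟩
      false                                           ∎
      where
      open ≡-Reasoning
      ρ' = drop m ρ
      window : take k ρ' ≡ take e ρ' ++ take K (drop e ρ')
      window = trans (cong (λ j → take j ρ') k≡e+K) (take-+ e K ρ')
      m+e+K≤ρ : m + e + K ≤ length ρ
      m+e+K≤ρ = ≤-trans (≤-reflexive (trans (+-assoc m e K) (cong (m +_) (sym k≡e+K)))) m+k≤ρ
      e+K≤ : e + K ≤ length ρ'
      e+K≤ = drop-budget m ρ (subst (λ j → m + j ≤ length ρ) k≡e+K m+k≤ρ)
      W-size = length-take-≤ ρ' (m+n≤o⇒m≤o e e+K≤)
      K-size = length-take-≤ (drop e ρ') (drop-budget e ρ' e+K≤)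
      inside-P : take e ρ' ++ take K (drop e ρ') ⊆ P
      inside-P = ⊆-trans (⊆-reflexive (sym window)) (⊆-trans (take-drop-⊆ k m ρ) ρ⊆P)
  conclude (inj₂ (redTriple {σ} {t} {u} {z} h≤σ σ⊆V ut zt zu)) = inj₂ (redDense k χ (e + 3) F
    (AllPairs.map (λ x>y x≡y → Fin.<⇒≢ x>y (sym x≡y)) (AllPairs-resp-⊆ (W++⊆P F₀⊆P₀) P-descending))
    (trans (length-++ W) (trans (cong₂ (λ a b → a + suc (suc (suc b))) W-length R-length) size))
    (≤-trans (+-monoʳ-≤ e (m≤m+n 3 h)) (≤-reflexive size))
    (subst (λ m → All Red (deletions (m + 3) F)) W-length
      (deletions-++ W drop-w (red-W (z ∷ʳ ⊆-refl) ut)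
        (red-W (refl ∷ u ∷ʳ ⊆-refl) zt) (red-W (refl ∷ refl ∷ t ∷ʳ ⊆-refl) zu))))
    where
    R = take h σ
    R-length : length R ≡ h
    R-length = length-take-≤ σ h≤σ
    F₀ = z ∷ u ∷ t ∷ R
    F = W ++ F₀
    size : e + suc (suc (suc h)) ≡ suc k
    size = trans (+-suc e K) (cong suc (sym k≡e+K))
    F₀⊆P₀ : F₀ ⊆ P₀
    F₀⊆P₀ = ⊆-trans (refl ∷ refl ∷ refl ∷ take-drop-⊆ h 0 σ) (reverse⁻ σ⊆V)
    Red : List (Fin N) → Set
    Red ys = χ (fromList ys) ≡ true
    red-++ : ∀ as {x y} → length as ≡ e → as ++ x ∷ y ∷ R ⊆ P →
      D (x ∷ y ∷ R) ≡ true → Red (as ++ x ∷ y ∷ R)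
    red-++ as la q r = trans (determined as _ la (cong (suc ∘ suc) R-length) q) r
    red-W : ∀ {x y} → x ∷ y ∷ R ⊆ F₀ → D (x ∷ y ∷ R) ≡ true → Red (W ++ x ∷ y ∷ R)
    red-W q = red-++ W W-length (W++⊆P (⊆-trans q F₀⊆P₀))
    -- Without one point of `W`, the `e` largest points are the rest of `W` and `z`; below them
    -- remain `u`, `t` and `R`, which are red by `ut`.
    drop-w : ∀ {W'} → W' ⊆ W → suc (length W') ≡ length W → Red (W' ++ F₀)
    drop-w {W'} W'⊆W l = subst Red (++-assoc W' (z ∷ []) (u ∷ t ∷ R))
      (red-++ (W' ++ z ∷ []) (trans (length-++ W') (trans (+-comm (length W') 1) (trans l W-length)))
        (⊆-trans (⊆-reflexive (++-assoc W' (z ∷ []) (u ∷ t ∷ R)))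
          (⊆-trans (++⁺ W'⊆W ⊆-refl) (W++⊆P F₀⊆P₀))) ut)

-- Tower estimates.

twr-mono-≤ : ∀ e {x y} → x ≤ y → twr (suc e) x ≤ twr (suc e) y
twr-mono-≤ zero x≤y = x≤y
twr-mono-≤ (suc e) x≤y = ^-monoʳ-≤ 2 (twr-mono-≤ e x≤y)

twr-mono-< : ∀ e {x y} → x < y → twr (suc e) x < twr (suc e) y
twr-mono-< zero x<y = x<y
twr-mono-< (suc e) x<y = ^-monoʳ-< 2 ≤-refl (twr-mono-< e x<y)

m*2^n≤2^[m*n] : ∀ m {n} → 1 ≤ n → m * 2 ^ n ≤ 2 ^ (m * n)
m*2^n≤2^[m*n] zero _ = z≤n
m*2^n≤2^[m*n] (suc zero) {n} _ =
  ≤-reflexive (trans (+-identityʳ (2 ^ n)) (cong (2 ^_) (sym (+-identityʳ n))))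
m*2^n≤2^[m*n] (suc (suc m)) {n} 1≤n = begin
  2 ^ n + suc m * 2 ^ n                    ≤⟨ +-mono-≤ (^-monoʳ-≤ 2 (m≤m+n n (m * n))) (m*2^n≤2^[m*n] (suc m) 1≤n) ⟩
  2 ^ (suc m * n) + 2 ^ (suc m * n)        ≡⟨ cong (2 ^ (suc m * n) +_) (+-identityʳ _) ⟨
  2 ^ (1 + suc m * n)                      ≤⟨ ^-monoʳ-≤ 2 (+-monoˡ-≤ (suc m * n) 1≤n) ⟩
  2 ^ (suc (suc m) * n)                    ∎
  where open ≤-Reasoning

twr>0 : ∀ e {x} → 1 ≤ x → 1 ≤ twr (suc e) x
twr>0 zero 1≤x = 1≤x
twr>0 (suc e) {x} _ = m^n>0 2 (twr (suc e) x)

m*twr≤twr[m*] : ∀ e m {x} → 1 ≤ x → m * twr (suc e) x ≤ twr (suc e) (m * x)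
m*twr≤twr[m*] zero m _ = ≤-refl
m*twr≤twr[m*] (suc e) m {x} 1≤x =
  ≤-trans (m*2^n≤2^[m*n] m (twr>0 e 1≤x)) (^-monoʳ-≤ 2 (m*twr≤twr[m*] e m 1≤x))

-- `(2 ^ x) ^ k` is `2 ^ (k * x)`, and by `m*twr≤twr[m*]` the factor `k` moves down to the innermost
-- argument. Each level after the first contributes one such factor, whence `k ^ e`.
poolSize≤twr : ∀ k M e → 1 ≤ k → 1 ≤ M → poolSize k M (suc e) ≤ twr (suc (suc e)) (k ^ e * M ^ k)
poolSize≤twr k M zero _ _ = ^-monoʳ-≤ 2 (≤-reflexive (sym (+-identityʳ (M ^ k))))
poolSize≤twr k M (suc e) 1≤k 1≤M = ^-monoʳ-≤ 2 (begin
  poolSize k M (suc e) ^ k                ≤⟨ ^-monoˡ-≤ k (poolSize≤twr k M e 1≤k 1≤M) ⟩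
  (2 ^ twr (suc e) (k ^ e * M ^ k)) ^ k   ≡⟨ ^-*-assoc 2 (twr (suc e) (k ^ e * M ^ k)) k ⟩
  2 ^ (twr (suc e) (k ^ e * M ^ k) * k)   ≡⟨ cong (2 ^_) (*-comm _ k) ⟩
  2 ^ (k * twr (suc e) (k ^ e * M ^ k))   ≤⟨ ^-monoʳ-≤ 2 (m*twr≤twr[m*] e k (*-mono-≤ (pos k e 1≤k) (pos M k 1≤M))) ⟩
  twr (suc (suc e)) (k * (k ^ e * M ^ k)) ≡⟨ cong (twr (suc (suc e))) (*-assoc k (k ^ e) (M ^ k)) ⟨
  twr (suc (suc e)) (k ^ suc e * M ^ k)   ∎)
  where
  open ≤-Reasoning
  pos : ∀ m i → 1 ≤ m → 1 ≤ m ^ i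
  pos m i 1≤m = m^n>0 m {{>-nonZero 1≤m}} i

^-distribʳ-* : ∀ o m n → (m * n) ^ o ≡ m ^ o * n ^ o
^-distribʳ-* zero m n = refl
^-distribʳ-* (suc o) m n =
  trans (cong (m * n *_) (^-distribʳ-* o m n)) ([m*n]*[o*p]≡[m*o]*[n*p] m n (m ^ o) (n ^ o))

-- `k ^ k` replaces `k ^ e` so that the constant depends on `k` alone, `(3 * (n * n)) ^ k` equals
-- `3 ^ k * n ^ (2 * k)`, and the `suc` makes the inequality strict.
poolSize<twr : ∀ k e n → e ≤ k → 1 ≤ k → 1 ≤ n →
  poolSize k (pathThreshold n) e < twr (suc e) (suc (k ^ k * 3 ^ k) * n ^ (2 * k))
poolSize<twr k e n e≤k 1≤k 1≤n = ≤-<-trans (below e e≤k) (twr-mono-< e strict)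
  where
  instance
    k≢0 : NonZero k
    k≢0 = >-nonZero 1≤k
    n≢0 : NonZero n
    n≢0 = >-nonZero 1≤n
  M = pathThreshold n
  1≤M : 1 ≤ M
  1≤M = *-mono-≤ {1} {3} (s≤s z≤n) (*-mono-≤ 1≤n 1≤n)
  below : ∀ e → e ≤ k → poolSize k M e ≤ twr (suc e) (k ^ k * M ^ k)
  below zero _ = begin
    M              ≡⟨ ^-identityʳ M ⟨
    M ^ 1          ≤⟨ ^-monoʳ-≤ M {{>-nonZero 1≤M}} 1≤k ⟩
    M ^ k          ≤⟨ m≤n*m (M ^ k) (k ^ k) {{m^n≢0 k k}} ⟩
    k ^ k * M ^ k  ∎
    where open ≤-Reasoning
  below (suc e) e<k = ≤-trans (poolSize≤twr k M e 1≤k 1≤M)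
    (twr-mono-≤ (suc e) (*-monoˡ-≤ (M ^ k) (^-monoʳ-≤ k (<⇒≤ e<k))))
  strict : k ^ k * M ^ k < suc (k ^ k * 3 ^ k) * n ^ (2 * k)
  strict = begin-strict
    k ^ k * M ^ k                          ≡⟨ cong (k ^ k *_) (^-distribʳ-* k 3 (n * n)) ⟩
    k ^ k * (3 ^ k * (n * n) ^ k)          ≡⟨ *-assoc (k ^ k) (3 ^ k) ((n * n) ^ k) ⟨
    k ^ k * 3 ^ k * (n * n) ^ k            ≡⟨ cong (λ m → k ^ k * 3 ^ k * (n * m) ^ k) (*-identityʳ n) ⟨
    k ^ k * 3 ^ k * (n ^ 2) ^ k            ≡⟨ cong (k ^ k * 3 ^ k *_) (^-*-assoc n 2 k) ⟩
    k ^ k * 3 ^ k * n ^ (2 * k)            <⟨ m<n+m _ (m^n>0 n (2 * k)) ⟩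
    suc (k ^ k * 3 ^ k) * n ^ (2 * k)      ∎
    where open ≤-Reasoning

theorem4 : ∀ (k : ℕ) → ∃[ c ] (∀ (t : ℕ) → 3 ≤ t → t ≤ k → ∀ (n : ℕ) → k + 1 < n →
    RamseyLT k (k + 1) t n (twr (t ∸ 2) (c * n ^ (2 * k))))
theorem4 k = suc (k ^ k * 3 ^ k) , bound
  where
  bound : ∀ t → 3 ≤ t → t ≤ k → ∀ n → k + 1 < n →
    RamseyLT k (k + 1) t n (twr (t ∸ 2) (suc (k ^ k * 3 ^ k) * n ^ (2 * k)))
  bound (suc (suc (suc e))) (s≤s (s≤s (s≤s z≤n))) e+3≤k n k<n =
    poolSize k (pathThreshold n) e ,
    poolSize<twr k e n (≤-trans (m≤n+m e 3) e+3≤k) (≤-trans (s≤s z≤n) e+3≤k)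
      (≤-trans (s≤s z≤n) k<n) ,
    -- With `t = e + 3` the reduced uniformity `h + 2` has to be `k - e`, so `h` is `k - (e + 2)`.
    subst₂ (λ k t → Arrows k (k + 1) t n (poolSize k (pathThreshold n) e)) k≡ (+-comm e 3)
      (arrows (k ∸ (e + 2)) e n (subst (λ k → k + 1 < n) (sym k≡) k<n))
    where
    e+2≤k : e + 2 ≤ k
    e+2≤k = ≤-trans (≤-reflexive (+-comm e 2)) (≤-trans (n≤1+n (2 + e)) e+3≤k)
    k≡ : suc (suc (k ∸ (e + 2) + e)) ≡ k
    k≡ = begin
      suc (suc (k ∸ (e + 2) + e))  ≡⟨ +-comm 2 (k ∸ (e + 2) + e) ⟩
      k ∸ (e + 2) + e + 2          ≡⟨ +-assoc (k ∸ (e + 2)) e 2 ⟩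
      k ∸ (e + 2) + (e + 2)        ≡⟨ m∸n+n≡m e+2≤k ⟩
      k                            ∎
      where open ≡-Reasoning
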